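{- For all integers $n,k\ge 1$ there is a bijection between $\mathcal{L}_{n,k}(12\cdots(k+1)(k+2))$ and the set of standard Young tableaux of shape $\langle (k+1)^n\rangle$, and hence $|\mathcal{L}_{n,k}(12\cdots(k+2))| = f^{\langle (k+1)^n\rangle}$.
   Context: A word $w$ contains a pattern $p\in S_m$ if some subsequence of $w$ of length $m$ is order-isomorphic to $p$; otherwise $w$ avoids $p$. For a set $S$ of permutations, $S(p)$ denotes the set of elements of $S$ avoiding $p$. For $n,k\ge 1$, $\mathcal{L}_{n,k}\subseteq S_{nk}$ is the set of permutations $w=w_{1,1}w_{1,2}\cdots w_{1,k}w_{2,1}\cdots w_{n,k}$ (written in $n$ consecutive blocks of length $k$) such that (L1) $w_{i,j}<w_{i,j+1}$ for all $1\le i\le n$, $1\le j\le k-1$, and (L2) $w_{i,j+1}>w_{i+1,j}$ for all $1\le i\le n-1$, $1\le j\le k-1$. $f^{\lambda}$ denotes the number of standard Young tableaux of shape $\lambda$; $\langle (k+1)^n\rangle$ is the rectangle with $n$ rows of length $k+1$. -}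

module Defs where

open import Level using (0ℓ)
open import Data.Nat using (ℕ; suc; _*_)
open import Data.Fin using (Fin; toℕ; combine; _<_)
open import Data.Product using (Σ; ∃; _×_; _,_; proj₁)
open import Function.Base using (id)
open import Function.Bundles using (_⇔_; Bijection)
open import Relation.Nullary using (¬_)
open import Relation.Binary.Bundles using (Setoid)
open import Relation.Binary.PropositionalEquality using (_≡_; refl; sym; trans)

-- A permutation of [N] in one-line notation: w i = w_{i+1} (0-based values).
-- Permutations are bijections Fin N → Fin N; injectivity suffices for finite sets.
IsPerm : ∀ {N} → (Fin N → Fin N) → Set
IsPerm {N} w = ∀ (i j : Fin N) → w i ≡ w j → i ≡ j

Contains : ∀ {N m} → (Fin N → Fin N) → (Fin m → Fin m) → Set
Contains {N} {m} w p =
  ∃ λ (σ : Fin m → Fin N) →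
    (∀ (a b : Fin m) → a < b → σ a < σ b) ×
    (∀ (a b : Fin m) → (w (σ a) < w (σ b)) ⇔ (p a < p b))

Avoids : ∀ {N m} → (Fin N → Fin N) → (Fin m → Fin m) → Set
Avoids w p = ¬ Contains w p

incPattern : (m : ℕ) → Fin m → Fin m
incPattern m = id

-- Block entry w_{i+1,j+1} = w at position i*k + j (0-based).
entry : ∀ {n k} → (Fin (n * k) → Fin (n * k)) → Fin n → Fin k → Fin (n * k)
entry w i j = w (combine i j)

InL : (n k : ℕ) → (Fin (n * k) → Fin (n * k)) → Set
InL n k w =
  IsPerm w ×
  (∀ (i : Fin n) (j j' : Fin k) → toℕ j' ≡ suc (toℕ j) →
     entry {n} {k} w i j < entry {n} {k} w i j') ×
  (∀ (i i' : Fin n) (j j' : Fin k) → toℕ i' ≡ suc (toℕ i) → toℕ j' ≡ suc (toℕ j) →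
     entry {n} {k} w i' j < entry {n} {k} w i j')

IsSYTRect : (r c : ℕ) → (Fin r × Fin c → Fin (r * c)) → Set
IsSYTRect r c T =
  (∀ i i' j j' → T (i , j) ≡ T (i' , j') → (i ≡ i' × j ≡ j')) ×
  (∀ i j j' → j < j' → T (i , j) < T (i , j')) ×
  (∀ i i' j → i < i' → T (i , j) < T (i' , j))

module _ {A B : Set} (P : (A → B) → Set) where
  subSetoid : Setoid 0ℓ 0ℓ
  subSetoid = record
    { Carrier = Σ (A → B) P
    ; _≈_ = λ x y → ∀ a → proj₁ x a ≡ proj₁ y a
    ; isEquivalence = record
      { refl = λ a → refl
      ; sym = λ e a → sym (e a)
      ; trans = λ e f a → trans (e a) (f a) } }

LAvoid : (n k : ℕ) → Setoid 0ℓ 0ℓ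
LAvoid n k = subSetoid (λ w → InL n k w × Avoids w (incPattern (suc (suc k))))

SYTRect : (n k : ℕ) → Setoid 0ℓ 0ℓ
SYTRect n k = subSetoid {Fin n × Fin (suc k)} {Fin (n * suc k)}
  (λ T → IsSYTRect n (suc k) T)

{-# OPTIONS --safe #-}
module Submission where

-- Remove the entries nk, nk + 1, ..., nk + n - 1 of a tableau one at a time. The cell of nk becomes a
-- hole, which jeu de taquin slides up and left to the corner; the k entries left beside it in the
-- first row form the last block of the word, and the rows below are a tableau with n - 1 rows, to
-- which the same is applied with nk + 1. Backwards, a block is placed on top of the tableau, shifted
-- right by one cell, and the hole slides back. As in Schensted's theorem, the first row records the
-- least last terms of the increasing subsequences of each length: so a word obtained from a tableau
-- has none of length k + 2, and for an avoiding word each block fits on top of the tableau built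
-- before it. Condition (L2) follows from avoidance: a failure w_{i,j+1} < w_{i+1,j} gives the
-- increasing subsequence w_{i,1}, ..., w_{i,j+1}, w_{i+1,j}, ..., w_{i+1,k}.

open import Defs
open import Data.Nat using (ℕ; zero; suc; _+_; _*_; _≤_; _<_; z≤n; s≤s; s≤s⁻¹; _≟_; _<?_; _∸_)
open import Data.Nat.Properties
open import Data.Fin using (Fin; zero; suc; toℕ; fromℕ<; combine; remQuot; opposite)
import Data.Fin as Fin
import Data.Fin.Properties as Finₚ
open import Data.Fin.Properties
  using (toℕ<n; toℕ-injective; toℕ-fromℕ<; any?; pigeonhole; remQuot-combine; combine-remQuot;
         combine-injective; combine-monoˡ-<; toℕ-combine; opposite-prop; opposite-involutive)
import Data.Product
open import Data.Product using (∃; _×_; _,_; proj₁; proj₂)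
import Data.Sum
open import Data.Sum using (_⊎_; inj₁; inj₂; [_,_]′)
open import Function.Base using (_∘_)
open import Function.Bundles using (Bijection; Equivalence; mk⇔)
open import Relation.Binary.Definitions using (tri<; tri≈; tri>)
open import Relation.Binary.PropositionalEquality
  using (_≡_; _≢_; _≗_; refl; sym; trans; cong; cong₂; subst; subst₂)
open import Relation.Nullary using (¬_; Dec; yes; no; contradiction)
open import Relation.Nullary.Decidable using (¬?; _×-dec_; decidable-stable)

-- Transpositions of two values, and the order of values with a movable hole.

exchange : ℕ → ℕ → ℕ → ℕ
exchange a b x with x ≟ a
... | yes _ = b
... | no  _ with x ≟ b
...   | yes _ = a
...   | no  _ = x

exchange-left : ∀ a b → exchange a b a ≡ b
exchange-left a b with a ≟ a
... | yes _  = refl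
... | no a≢a = contradiction refl a≢a

exchange-right : ∀ a b → exchange a b b ≡ a
exchange-right a b with b ≟ a
... | yes b≡a = b≡a
... | no  _ with b ≟ b
...   | yes _  = refl
...   | no b≢b = contradiction refl b≢b

exchange-other : ∀ {a b x} → x ≢ a → x ≢ b → exchange a b x ≡ x
exchange-other {a} {b} {x} x≢a x≢b with x ≟ a
... | yes x≡a = contradiction x≡a x≢a
... | no  _ with x ≟ b
...   | yes x≡b = contradiction x≡b x≢b
...   | no  _   = refl

data ExchangeView (a b x : ℕ) : Set where
  is-left  : x ≡ a → exchange a b x ≡ b → ExchangeView a b x
  is-right : x ≡ b → exchange a b x ≡ a → ExchangeView a b x
  is-other : x ≢ a → x ≢ b → exchange a b x ≡ x → ExchangeView a b x

exchangeView : ∀ a b x → ExchangeView a b x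
exchangeView a b x with x ≟ a
... | yes refl = is-left refl (exchange-left a b)
... | no x≢a with x ≟ b
...   | yes refl = is-right refl (exchange-right a b)
...   | no x≢b   = is-other x≢a x≢b (exchange-other x≢a x≢b)

exchange-involutive : ∀ a b x → exchange a b (exchange a b x) ≡ x
exchange-involutive a b x with exchangeView a b x
... | is-left refl e    = trans (cong (exchange a b) e) (exchange-right a b)
... | is-right refl e   = trans (cong (exchange a b) e) (exchange-left a b)
... | is-other x≢a x≢b e = trans (cong (exchange a b) e) e

exchange-injective : ∀ a b {x y} → exchange a b x ≡ exchange a b y → x ≡ y
exchange-injective a b {x} {y} e =
  trans (sym (exchange-involutive a b x)) (trans (cong (exchange a b) e) (exchange-involutive a b y))

-- The hole carries the value h but is compared with the other values as if it lay just below v.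
key : ℕ → ℕ → ℕ → ℕ
key h v x with x ≟ h
... | yes _ = v
... | no  _ with x <? v
...   | yes _ = x
...   | no  _ = suc x

key-hole : ∀ h v → key h v h ≡ v
key-hole h v with h ≟ h
... | yes _  = refl
... | no h≢h = contradiction refl h≢h

key-below : ∀ {h v x} → x ≢ h → x < v → key h v x ≡ x
key-below {h} {v} {x} x≢h x<v with x ≟ h
... | yes x≡h = contradiction x≡h x≢h
... | no  _ with x <? v
...   | yes _  = refl
...   | no x≮v = contradiction x<v x≮v

key-above : ∀ {h v x} → x ≢ h → v ≤ x → key h v x ≡ suc x
key-above {h} {v} {x} x≢h v≤x with x ≟ h
... | yes x≡h = contradiction x≡h x≢h
... | no  _ with x <? v
...   | yes x<v = contradiction x<v (≤⇒≯ v≤x)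
...   | no  _   = refl

key-mono : ∀ {h v x y} → x ≢ h → y ≢ h → x < y → key h v x < key h v y
key-mono {h} {v} {x} {y} x≢h y≢h x<y with x <? v | y <? v
... | yes x<v | yes y<v = subst₂ _<_ (sym (key-below x≢h x<v)) (sym (key-below y≢h y<v)) x<y
... | yes x<v | no y≮v  =
  subst₂ _<_ (sym (key-below x≢h x<v)) (sym (key-above y≢h (≮⇒≥ y≮v))) (m<n⇒m<1+n x<y)
... | no x≮v  | yes y<v = contradiction (<-trans x<y y<v) x≮v
... | no x≮v  | no y≮v  =
  subst₂ _<_ (sym (key-above x≢h (≮⇒≥ x≮v))) (sym (key-above y≢h (≮⇒≥ y≮v))) (s≤s x<y)

key-cancel : ∀ {h v x y} → x ≢ h → y ≢ h → key h v x < key h v y → x < y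
key-cancel {h} {v} {x} {y} x≢h y≢h kx<ky with <-cmp x y
... | tri< x<y _ _ = x<y
... | tri≈ _ refl _ = contradiction kx<ky (<-irrefl refl)
... | tri> _ _ y<x = contradiction kx<ky (<-asym (key-mono y≢h x≢h y<x))

-- With the hole just above `v`, the value `v` and the hole have keys `v` and `suc v`; with the hole
-- just below `v` they have the same two keys the other way round. The transposition compensates for
-- this.
key-exchange : ∀ {h v} → v ≢ h → ∀ x → key h v (exchange v h x) ≡ key h (suc v) x
key-exchange {h} {v} v≢h x with exchangeView v h x
... | is-left refl e  = trans (cong (key h v) e) (trans (key-hole h v) (sym (key-below v≢h ≤-refl)))
... | is-right refl e = trans (cong (key h v) e) (trans (key-above v≢h ≤-refl) (sym (key-hole h (suc v))))
... | is-other x≢v x≢h e with x <? v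
...   | yes x<v = trans (cong (key h v) e) (trans (key-below x≢h x<v) (sym (key-below x≢h (m<n⇒m<1+n x<v))))
...   | no x≮v  = trans (cong (key h v) e)
  (trans (key-above x≢h (≮⇒≥ x≮v)) (sym (key-above x≢h (≤∧≢⇒< (≮⇒≥ x≮v) (x≢v ∘ sym)))))

-- Lowering the hole from `suc v` to `v` takes it past the value `v` alone, so the comparison of any
-- other pair is unaffected.
key-order-change : ∀ {h v x y} → key h (suc v) x < key h (suc v) y → ¬ key h v x < key h v y →
                   x ≡ v × y ≡ h
key-order-change {h} {v} {x} {y} upper ¬lower = cases (x ≟ h) (y ≟ h)
  where
  cases : Dec (x ≡ h) → Dec (y ≡ h) → x ≡ v × y ≡ h
  cases (yes refl) (yes refl) = contradiction upper (<-irrefl refl)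
  cases (no x≢h) (no y≢h) = contradiction (key-mono x≢h y≢h (key-cancel {v = suc v} x≢h y≢h upper)) ¬lower
  cases (no x≢h) (yes refl) with <-cmp x v
  ... | tri≈ _ x≡v _ = x≡v , refl
  ... | tri< x<v _ _ =
    contradiction (subst₂ _<_ (sym (key-below x≢h x<v)) (sym (key-hole h v)) x<v) ¬lower
  ... | tri> _ _ v<x = contradiction (subst₂ _<_ (key-above x≢h v<x) (key-hole h (suc v)) upper)
    (<-asym (s≤s v<x))
  cases (yes refl) (no y≢h) with <-cmp y (suc v)
  ... | tri< y<1+v _ _ = contradiction
    (subst₂ _<_ (key-hole h (suc v)) (key-below y≢h y<1+v) upper) (<-asym y<1+v)
  ... | tri≈ _ refl _ = contradiction
    (subst₂ _<_ (sym (key-hole h v)) (sym (key-above y≢h (n≤1+n v))) (m<n⇒m<1+n ≤-refl)) ¬lower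
  ... | tri> _ _ 1+v<y = contradiction (subst₂ _<_ (sym (key-hole h v))
    (sym (key-above y≢h (<⇒≤ (<⇒≤ 1+v<y)))) (m<n⇒m<1+n (<⇒≤ 1+v<y))) ¬lower

key-zero-mono : ∀ {h x y} → y ≢ h → x ≡ h ⊎ x < y → key h 0 x < key h 0 y
key-zero-mono {h} {x} {y} y≢h = λ { (inj₁ x≡h) → hole x≡h ; (inj₂ x<y) → cases x<y (x ≟ h) }
  where
  hole : x ≡ h → key h 0 x < key h 0 y
  hole refl = subst₂ _<_ (sym (key-hole h 0)) (sym (key-above y≢h z≤n)) (s≤s z≤n)
  cases : x < y → Dec (x ≡ h) → key h 0 x < key h 0 y
  cases _   (yes x≡h) = hole x≡h
  cases x<y (no x≢h)  = key-mono x≢h y≢h x<y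

key-zero-minimum : ∀ {h x} → key h 0 x ≤ key h 0 h → x ≡ h
key-zero-minimum {h} {x} le = decidable-stable (x ≟ h) λ x≢h →
  contradiction (subst₂ _≤_ (key-above x≢h z≤n) (key-hole h 0) le) λ ()

key-exchange′ : ∀ {h v} → v ≢ h → ∀ x → key h (suc v) (exchange v h x) ≡ key h v x
key-exchange′ {h} {v} v≢h x =
  trans (sym (key-exchange v≢h (exchange v h x))) (cong (key h v) (exchange-involutive v h x))

key-order-change′ : ∀ {h v x y} → v ≢ h →
                    key h v x < key h v y → ¬ key h (suc v) x < key h (suc v) y → x ≡ h × y ≡ v
key-order-change′ {h} {v} {x} {y} v≢h lower ¬upper
  with ex≡v , ey≡h ← key-order-change
         (subst₂ _<_ (sym (key-exchange′ v≢h x)) (sym (key-exchange′ v≢h y)) lower)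
         (¬upper ∘ subst₂ _<_ (key-exchange v≢h x) (key-exchange v≢h y))
  = exchange-injective v h (trans ex≡v (sym (exchange-right v h)))
  , exchange-injective v h (trans ey≡h (sym (exchange-left v h)))

-- Placing the hole just below `v` instead of at `h` alters its comparison only with values from `v`
-- to `h - 1`. The range condition keeps the smaller term out of that gap, where an inequality would
-- be lost.
key-gap-mono : ∀ {h v x y} → v ≤ h → x < v ⊎ h ≤ x → x < y → key h v x < key h v y
key-gap-mono {h} {v} {x} {y} v≤h x-range x<y = cases (x ≟ h) (y ≟ h)
  where
  cases : Dec (x ≡ h) → Dec (y ≡ h) → key h v x < key h v y
  cases (yes refl) (yes refl) = contradiction x<y (<-irrefl refl)
  cases (yes refl) (no y≢h) = subst₂ _<_ (sym (key-hole h v))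
    (sym (key-above y≢h (≤-trans v≤h (<⇒≤ x<y)))) (s≤s (≤-trans v≤h (<⇒≤ x<y)))
  cases (no x≢h) (no y≢h) = key-mono x≢h y≢h x<y
  cases (no x≢h) (yes refl) =
    [ (λ x<v → subst₂ _<_ (sym (key-below x≢h x<v)) (sym (key-hole h v)) x<v)
    , (λ h≤x → contradiction x<y (≤⇒≯ h≤x)) ]′ x-range

key-gap-cancel : ∀ {h v x y} → v ≤ h → y < v ⊎ h ≤ y → key h v x < key h v y → x < y
key-gap-cancel {h} {v} {x} {y} v≤h y-range kx<ky with <-cmp x y
... | tri< x<y _ _ = x<y
... | tri≈ _ refl _ = contradiction kx<ky (<-irrefl refl)
... | tri> _ _ y<x = contradiction kx<ky (<-asym (key-gap-mono v≤h y-range y<x))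

-- Sequences that increase from some index on.

module Increments {m : ℕ} (g : Fin m → ℕ) (s : ℕ)
  (step : ∀ {i j} → s ≤ toℕ i → toℕ j ≡ suc (toℕ i) → g i < g j) where

  -- The number of steps is kept in the bound because `corner-row-small` counts how far a column
  -- must grow.
  gap : ∀ d {i j} → s ≤ toℕ i → toℕ j ≡ d + toℕ i → d + g i ≤ g j
  gap zero    s≤i e with refl ← toℕ-injective e = ≤-refl
  gap (suc d) {i} {j} s≤i e =
    ≤-trans (s≤s (gap d s≤i mid≡)) (step (≤-trans s≤i (≤-trans (m≤n+m _ d) (≤-reflexive (sym mid≡))))
                                         (trans e (cong suc (sym mid≡))))
    where
    bound : d + toℕ i < m
    bound = <-trans (subst (d + toℕ i <_) (sym e) ≤-refl) (toℕ<n j)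
    mid≡ : toℕ (fromℕ< bound) ≡ d + toℕ i
    mid≡ = toℕ-fromℕ< bound

  monotone : ∀ {i j} → s ≤ toℕ i → toℕ i ≤ toℕ j → g i ≤ g j
  monotone {i} {j} s≤i i≤j =
    ≤-trans (m≤n+m _ (toℕ j ∸ toℕ i)) (gap (toℕ j ∸ toℕ i) s≤i (sym (m∸n+n≡m i≤j)))

  strict : ∀ {i j} → s ≤ toℕ i → toℕ i < toℕ j → g i < g j
  strict {i} {j} s≤i i<j = ≤-trans (+-monoˡ-≤ (g i) (m<n⇒0<n∸m i<j))
    (gap (toℕ j ∸ toℕ i) s≤i (sym (m∸n+n≡m (<⇒≤ i<j))))

opposite-anti : ∀ {m} {i j : Fin m} → toℕ i < toℕ j → toℕ (opposite j) < toℕ (opposite i)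
opposite-anti {m} {i} {j} i<j = subst₂ _<_ (sym (opposite-prop j)) (sym (opposite-prop i))
  (∸-monoʳ-< (s≤s i<j) (toℕ<n j))

-- Cells of the rectangle, and standardness of the rows from `s` on.

module Rectangle (n k : ℕ) where

  K : ℕ
  K = n * k

  Cell : Set
  Cell = Fin n × Fin (suc k)

  row : Cell → ℕ
  row p = toℕ (proj₁ p)

  Arr : Set
  Arr = Cell → ℕ

  data _⋖_ : Cell → Cell → Set where
    right : ∀ {r c c'} → toℕ c' ≡ suc (toℕ c) → (r , c) ⋖ (r , c')
    down  : ∀ {r r' c} → toℕ r' ≡ suc (toℕ r) → (r , c) ⋖ (r' , c)

  _⋖?_ : ∀ p q → Dec (p ⋖ q)
  (r , c) ⋖? (r' , c') with r Finₚ.≟ r' | toℕ c' ≟ suc (toℕ c)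
  ... | yes refl | yes e = yes (right e)
  ... | yes refl | no ¬e = no λ { (right e) → ¬e e ; (down e) → 1+n≢n (sym e) }
  ... | no r≢r' | _ with toℕ r' ≟ suc (toℕ r) | c Finₚ.≟ c'
  ...   | yes e | yes refl = yes (down e)
  ...   | no ¬e | _        = no λ { (right _) → r≢r' refl ; (down e) → ¬e e }
  ...   | yes _ | no c≢c'  = no λ { (right _) → r≢r' refl ; (down _) → c≢c' refl }

  ⋖-row : ∀ {p q} → p ⋖ q → row p ≤ row q
  ⋖-row (right _) = ≤-refl
  ⋖-row (down e)  = ≤-trans (n≤1+n _) (≤-reflexive (sym e))

  Std : ℕ → Arr → Set
  Std s f = ∀ {p q} → s ≤ row p → p ⋖ q → f p < f q

  -- The four coordinates are quantified separately so that `any?` on `Fin` can search for a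
  -- failure. The pair of cells found is the pair that a toggle exchanges.
  Violation : ℕ → Arr → Set
  Violation s f = ∃ λ r → ∃ λ c → ∃ λ r' → ∃ λ c' →
    s ≤ toℕ r × (r , c) ⋖ (r' , c') × ¬ f (r , c) < f (r' , c')

  violation? : ∀ s f → Dec (Violation s f)
  violation? s f = any? λ r → any? λ c → any? λ r' → any? λ c' →
    (s ≤? toℕ r) ×-dec ((r , c) ⋖? (r' , c')) ×-dec ¬? (f (r , c) <? f (r' , c'))

  ¬violation⇒Std : ∀ {s f} → ¬ Violation s f → Std s f
  ¬violation⇒Std {s} {f} ¬v {p} {q} s≤p p⋖q =
    decidable-stable (f p <? f q) λ ≮ → ¬v (_ , _ , _ , _ , s≤p , p⋖q , ≮)

  Std⇒¬violation : ∀ {s f} → Std s f → ¬ Violation s f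
  Std⇒¬violation std (_ , _ , _ , _ , s≤p , p⋖q , ≮) = ≮ (std s≤p p⋖q)

  Std-cong : ∀ {s f g} → f ≗ g → Std s f → Std s g
  Std-cong f≗g std {p} {q} s≤p p⋖q = subst₂ _<_ (f≗g p) (f≗g q) (std s≤p p⋖q)

  Violation-cong : ∀ {s f g} → f ≗ g → Violation s f → Violation s g
  Violation-cong f≗g (r , c , r' , c' , s≤r , p⋖q , ≮) =
    r , c , r' , c' , s≤r , p⋖q , ≮ ∘ subst₂ _<_ (sym (f≗g _)) (sym (f≗g _))

  Std-row : ∀ {s f} → Std s f → ∀ {r c c'} → s ≤ toℕ r → toℕ c < toℕ c' → f (r , c) < f (r , c')
  Std-row {s} {f} std {r} s≤r =
    Increments.strict (λ c → f (r , c)) 0 (λ _ e → std s≤r (right e)) z≤n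

  Std-row-≤ : ∀ {s f} → Std s f → ∀ {r c c'} → s ≤ toℕ r → toℕ c ≤ toℕ c' → f (r , c) ≤ f (r , c')
  Std-row-≤ {s} {f} std {r} s≤r =
    Increments.monotone (λ c → f (r , c)) 0 (λ _ e → std s≤r (right e)) z≤n

  Std-column : ∀ {s f} → Std s f → ∀ {r r' c} → s ≤ toℕ r → toℕ r < toℕ r' → f (r , c) < f (r' , c)
  Std-column {s} {f} std {c = c} =
    Increments.strict (λ r → f (r , c)) s (λ s≤r e → std s≤r (down e))

  Std-column-≤ : ∀ {s f} → Std s f → ∀ {r r' c} → s ≤ toℕ r → toℕ r ≤ toℕ r' → f (r , c) ≤ f (r' , c)
  Std-column-≤ {s} {f} std {c = c} =
    Increments.monotone (λ r → f (r , c)) s (λ s≤r e → std s≤r (down e))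

  -- Toggles and their inverses.

  -- One slide is a composite of toggles. As v decreases, the hole moves from just above v to just below
  -- v in the order of values; if this breaks standardness, v and the hole are neighbours and trade
  -- places. Such a toggle is undone by the toggle in the other direction, so slides are invertible.
  opaque
    toggle : ℕ → (ℕ → ℕ) → (ℕ → ℕ) → Arr → Arr
    toggle s e f A with violation? s (f ∘ A)
    ... | yes _ = e ∘ A
    ... | no  _ = A

    toggle-yes : ∀ {s e f A} → Violation s (f ∘ A) → toggle s e f A ≗ e ∘ A
    toggle-yes {s} {e} {f} {A} v p with violation? s (f ∘ A)
    ... | yes _ = refl
    ... | no ¬v = contradiction v ¬v

    toggle-no : ∀ {s e f A} → ¬ Violation s (f ∘ A) → toggle s e f A ≗ A
    toggle-no {s} {e} {f} {A} ¬v p with violation? s (f ∘ A)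
    ... | yes v = contradiction v ¬v
    ... | no  _ = refl

  toggle-cong : ∀ s e f {A B} → A ≗ B → toggle s e f A ≗ toggle s e f B
  toggle-cong s e f {A} {B} A≗B p with violation? s (f ∘ A)
  ... | yes v = trans (toggle-yes {A = A} v p) (trans (cong e (A≗B p))
    (sym (toggle-yes {A = B} (Violation-cong (cong f ∘ A≗B) v) p)))
  ... | no ¬v = trans (toggle-no {A = A} ¬v p) (trans (A≗B p)
    (sym (toggle-no {A = B} (¬v ∘ Violation-cong (cong f ∘ sym ∘ A≗B)) p)))

  module Toggle (s : ℕ) (e f g : ℕ → ℕ)
    (involutive : ∀ x → e (e x) ≡ x) (f∘e≗g : ∀ x → f (e x) ≡ g x) where

    g∘e≗f : ∀ x → g (e x) ≡ f x
    g∘e≗f x = trans (sym (f∘e≗g (e x))) (cong f (involutive x))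

    -- After an exchange, `f` compares exactly as `g` did before it; if there is no violation,
    -- nothing changes and `f` is standard already.
    toggle-Std : ∀ {A} → Std s (g ∘ A) → Std s (f ∘ toggle s e f A)
    toggle-Std {A} std with violation? s (f ∘ A)
    ... | yes v = Std-cong (λ p → sym (trans (cong f (toggle-yes {A = A} v p)) (f∘e≗g (A p)))) std
    ... | no ¬v = Std-cong (λ p → sym (cong f (toggle-no {A = A} ¬v p))) (¬violation⇒Std ¬v)

    -- The second toggle repeats the decision of the first. After an exchange, `g` sees the
    -- violation that `f` saw before, and `e` undoes itself; otherwise `g` is standard by assumption
    -- and nothing happens.
    toggle-inverse : ∀ {A} → Std s (g ∘ A) → toggle s e g (toggle s e f A) ≗ A
    toggle-inverse {A} std p with violation? s (f ∘ A)
    ... | yes v = trans (toggle-yes {A = toggle s e f A} (Violation-cong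
        (λ q → sym (trans (cong g (toggle-yes {A = A} v q)) (g∘e≗f (A q)))) v) p)
      (trans (cong e (toggle-yes {A = A} v p)) (involutive (A p)))
    ... | no ¬v = trans (toggle-cong s e g (toggle-no {A = A} ¬v) p)
      (toggle-no {A = A} (Std⇒¬violation std) p)

  -- Arrays with finished rows.

  -- After s slides the rows r < s are finished: column 0 holds the r-th removed entry K + r, and the
  -- other k columns hold a block of the word.
  record Frame (s : ℕ) (A : Arr) : Set where
    field
      injective  : ∀ {p q} → A p ≡ A q → p ≡ q
      bounded    : ∀ p → A p < K + n
      holes      : ∀ {r} → toℕ r < s → A (r , zero) ≡ K + toℕ r
      small      : ∀ {r} c → toℕ r < s → A (r , suc c) < K
      increasing : ∀ {r c c'} → toℕ r < s → toℕ c' ≡ suc (toℕ c) → A (r , suc c) < A (r , suc c')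

  open Frame

  Agree : ℕ → Arr → Arr → Set
  Agree s A B = ∀ p → row p < s → B p ≡ A p

  Frame-transfer : ∀ {s A B} → Frame s A → (∀ {p q} → B p ≡ B q → p ≡ q) →
                   (∀ p → B p < K + n) → Agree s A B → Frame s B
  Frame-transfer F inj bnd agree = record
    { injective  = inj
    ; bounded    = bnd
    ; holes      = λ r<s → trans (agree _ r<s) (holes F r<s)
    ; small      = λ c r<s → subst (_< K) (sym (agree _ r<s)) (small F c r<s)
    ; increasing = λ r<s e → subst₂ _<_ (sym (agree _ r<s)) (sym (agree _ r<s)) (increasing F r<s e)
    }

  Frame-cong : ∀ {s A B} → A ≗ B → Frame s A → Frame s B
  Frame-cong A≗B F = Frame-transfer F
    (λ {p} {q} e → injective F (trans (A≗B p) (trans e (sym (A≗B q)))))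
    (λ p → subst (_< K + n) (A≗B p) (bounded F p)) (λ p _ → sym (A≗B p))

  Frame-weaken : ∀ {s A} → Frame (suc s) A → Frame s A
  Frame-weaken F = record
    { injective  = injective F
    ; bounded    = bounded F
    ; holes      = holes F ∘ m<n⇒m<1+n
    ; small      = λ c → small F c ∘ m<n⇒m<1+n
    ; increasing = increasing F ∘ m<n⇒m<1+n
    }

  Frame-exchange : ∀ {s a b A B p q} → s ≤ row p → s ≤ row q → A p ≡ a → A q ≡ b →
                   B ≗ exchange a b ∘ A → Frame s A → Frame s B × Agree s A B
  Frame-exchange {s} {a} {b} {A} {B} {p} {q} s≤p s≤q Ap≡a Aq≡b B≗ F =
    Frame-transfer F inj bnd agree , agree
    where
    agree : Agree s A B
    agree x x<s = trans (B≗ x) (exchange-other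
      (λ Ax≡a → <⇒≱ x<s (subst (λ y → s ≤ row y) (injective F (trans Ap≡a (sym Ax≡a))) s≤p))
      (λ Ax≡b → <⇒≱ x<s (subst (λ y → s ≤ row y) (injective F (trans Aq≡b (sym Ax≡b))) s≤q)))
    inj : ∀ {x y} → B x ≡ B y → x ≡ y
    inj {x} {y} e = injective F (exchange-injective a b (trans (sym (B≗ x)) (trans e (B≗ y))))
    bnd : ∀ x → B x < K + n
    bnd x with exchangeView a b (A x)
    ... | is-left _ e    = subst (_< K + n) (sym (trans (B≗ x) (trans e (sym Aq≡b)))) (bounded F q)
    ... | is-right _ e   = subst (_< K + n) (sym (trans (B≗ x) (trans e (sym Ap≡a)))) (bounded F p)
    ... | is-other _ _ e = subst (_< K + n) (sym (trans (B≗ x) e)) (bounded F x)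

  -- Slides of the hole through the unfinished rows.

  hole : ℕ → ℕ
  hole s = K + s

  -- A slide runs from `v = K`, where the hole compares as its own value does within the unfinished
  -- rows, down to `v = 0`, where it lies below all other values. `Good` describes the array between
  -- slides.
  State : ℕ → ℕ → Arr → Set
  State s v A = Frame s A × Std s (key (hole s) v ∘ A)

  Good : ℕ → Arr → Set
  Good s A = Frame s A × Std s A

  small≢hole : ∀ {v s} → v < K → v ≢ hole s
  small≢hole {s = s} v<K refl = <⇒≱ v<K (m≤m+n K s)

  -- A single jeu de taquin move takes the hole left or up, from `q` to `p`. As `v` decreases, it
  -- reaches the larger of the two neighbours first, which is the one that has to move.
  data Step (s v : ℕ) (A B : Arr) : Set where
    stay : B ≗ A → Step s v A B
    move : ∀ {p q} → s ≤ row p → p ⋖ q → A p ≡ v → A q ≡ hole s → B ≗ exchange v (hole s) ∘ A →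
           Step s v A B

  toggle↓ : ℕ → ℕ → Arr → Arr
  toggle↓ s v = toggle s (exchange v (hole s)) (key (hole s) v)

  toggle↑ : ℕ → ℕ → Arr → Arr
  toggle↑ s v = toggle s (exchange v (hole s)) (key (hole s) (suc v))

  module Toggle↓ {s v : ℕ} (v<K : v < K) = Toggle s (exchange v (hole s)) (key (hole s) v)
    (key (hole s) (suc v)) (exchange-involutive v (hole s)) (key-exchange (small≢hole v<K))

  module Toggle↑ {s v : ℕ} (v<K : v < K) = Toggle s (exchange v (hole s)) (key (hole s) (suc v))
    (key (hole s) v) (exchange-involutive v (hole s)) (key-exchange′ (small≢hole v<K))

  -- The order at `suc v` is standard, so cells that violate the order at `v` must hold the one pair
  -- whose comparison changes.
  toggle↓-Step : ∀ {s v A} → Std s (key (hole s) (suc v) ∘ A) → Step s v A (toggle↓ s v A)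
  toggle↓-Step {s} {v} {A} std with violation? s (key (hole s) v ∘ A)
  ... | no ¬violation = stay (toggle-no {A = A} ¬violation)
  ... | yes violation@(_ , _ , _ , _ , s≤p , p⋖q , ≮)
    with Ap≡v , Aq≡h ← key-order-change (std s≤p p⋖q) ≮ =
    move s≤p p⋖q Ap≡v Aq≡h (toggle-yes {A = A} violation)

  Step-Frame : ∀ {s v A B} → Step s v A B → Frame s A → Frame s B × Agree s A B
  Step-Frame (stay B≗A) F = Frame-cong (sym ∘ B≗A) F , λ p _ → B≗A p
  Step-Frame (move s≤p p⋖q Ap≡v Aq≡h B≗) F =
    Frame-exchange s≤p (≤-trans s≤p (⋖-row p⋖q)) Ap≡v Aq≡h B≗ F

  toggle↑-Frame : ∀ {s v A} → v < K → State s v A →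
                  Frame s (toggle↑ s v A) × Agree s A (toggle↑ s v A)
  toggle↑-Frame {s} {v} {A} v<K (F , std) with violation? s (key (hole s) (suc v) ∘ A)
  ... | no ¬violation =
    Frame-cong (sym ∘ toggle-no {A = A} ¬violation) F , λ p _ → toggle-no {A = A} ¬violation p
  ... | yes violation@(_ , _ , _ , _ , s≤p , p⋖q , ≮)
    with Ap≡h , Aq≡v ← key-order-change′ (small≢hole {s = s} v<K) (std s≤p p⋖q) ≮ =
    Frame-exchange (≤-trans s≤p (⋖-row p⋖q)) s≤p Aq≡v Ap≡h (toggle-yes {A = A} violation) F

  toggle↓-State : ∀ {s v A} → v < K → State s (suc v) A → State s v (toggle↓ s v A)
  toggle↓-State {s} {v} {A} v<K (F , std) =
    proj₁ (Step-Frame (toggle↓-Step {s} {v} std) F) , λ {p} {q} → Toggle↓.toggle-Std v<K {A} std {p} {q}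

  slide↓ : ℕ → ℕ → Arr → Arr
  slide↓ s zero    A = A
  slide↓ s (suc v) A = slide↓ s v (toggle↓ s v A)

  slide↑ : ℕ → ℕ → Arr → Arr
  slide↑ s zero    A = A
  slide↑ s (suc v) A = toggle↑ s v (slide↑ s v A)

  slide↓-cong : ∀ s v {A B} → A ≗ B → slide↓ s v A ≗ slide↓ s v B
  slide↓-cong s zero    A≗B = A≗B
  slide↓-cong s (suc v) A≗B = slide↓-cong s v (toggle-cong s _ _ A≗B)

  slide↑-cong : ∀ s v {A B} → A ≗ B → slide↑ s v A ≗ slide↑ s v B
  slide↑-cong s zero    A≗B = A≗B
  slide↑-cong s (suc v) A≗B = toggle-cong s _ _ (slide↑-cong s v A≗B)

  -- The property is left arbitrary so that both `Agree` and `Phase` can be followed through the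
  -- moves.
  slide↓-induction : ∀ {s} (P : Arr → Set) →
    (∀ {v A B} → v < K → Frame s A → State s v B → Step s v A B → P A → P B) →
    ∀ v {A} → v ≤ K → State s v A → P A → State s 0 (slide↓ s v A) × P (slide↓ s v A)
  slide↓-induction P next zero    v≤K state PA = state , PA
  slide↓-induction {s} P next (suc v) v<K state@(F , std) PA =
    slide↓-induction P next v (<⇒≤ v<K) state′ (next v<K F state′ (toggle↓-Step {s} {v} std) PA)
    where state′ = toggle↓-State v<K state

  slide↓-State : ∀ {s} v {A} → v ≤ K → State s v A →
                 State s 0 (slide↓ s v A) × Agree s A (slide↓ s v A)
  slide↓-State {s} v {A} v≤K state = slide↓-induction (Agree s A)
    (λ _ F _ step agree p p<s → trans (proj₂ (Step-Frame step F) p p<s) (agree p p<s))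
    v v≤K state (λ _ _ → refl)

  slide↑-State : ∀ {s} v {A} → v ≤ K → State s 0 A →
                 State s v (slide↑ s v A) × Agree s A (slide↑ s v A)
  slide↑-State zero    v≤K state = state , λ _ _ → refl
  slide↑-State {s} (suc v) v<K state
    with (F , std) , agree ← slide↑-State v (<⇒≤ v<K) state
    with F′ , agree′ ← toggle↑-Frame v<K (F , std) =
    (F′ , λ {p} {q} → Toggle↑.toggle-Std v<K {slide↑ s v _} std {p} {q}) , λ p p<s → trans (agree′ p p<s) (agree p p<s)

  slide↑∘slide↓ : ∀ {s} v {A} → v ≤ K → State s v A → slide↑ s v (slide↓ s v A) ≗ A
  slide↑∘slide↓ zero    v≤K _ p = refl
  slide↑∘slide↓ {s} (suc v) v<K state@(_ , std) p = trans
    (toggle-cong s _ _ (slide↑∘slide↓ v (<⇒≤ v<K) (toggle↓-State v<K state)) p)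
    (Toggle↓.toggle-inverse v<K std p)

  slide↓∘slide↑ : ∀ {s} v {A} → v ≤ K → State s 0 A → slide↓ s v (slide↑ s v A) ≗ A
  slide↓∘slide↑ zero    v≤K _ p = refl
  slide↓∘slide↑ {s} (suc v) v<K state p = trans
    (slide↓-cong s v (Toggle↑.toggle-inverse v<K (proj₂ (proj₁ (slide↑-State v (<⇒≤ v<K) state)))) p)
    (slide↓∘slide↑ v (<⇒≤ v<K) state p)

  -- The values `K + t` with `t < s` already stand in column 0 of the finished rows, so injectivity
  -- keeps them out of the others.
  value-gap : ∀ {s A} → Frame s A → ∀ {p} → s ≤ row p → A p < K ⊎ hole s ≤ A p
  value-gap {s} {A} F {p} s≤p with A p <? K | hole s ≤? A p
  ... | yes A<K | _       = inj₁ A<K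
  ... | _       | yes h≤A = inj₂ h≤A
  ... | no A≮K  | no h≰A  = contradiction
    (subst (s ≤_) (trans (sym (cong row r≡p)) (toℕ-fromℕ< t<n)) s≤p) (<⇒≱ t<s)
    where
    t = A p ∸ K
    K+t≡ : K + t ≡ A p
    K+t≡ = m+[n∸m]≡n (≮⇒≥ A≮K)
    t<s : t < s
    t<s = +-cancelˡ-< K t s (subst (_< hole s) (sym K+t≡) (≰⇒> h≰A))
    t<n : t < n
    t<n = <-≤-trans t<s (≤-trans s≤p (<⇒≤ (toℕ<n (proj₁ p))))
    r≡p : (fromℕ< t<n , zero) ≡ p
    r≡p = injective F (trans (holes F (subst (_< s) (sym (toℕ-fromℕ< t<n)) t<s))
      (trans (cong (K +_) (toℕ-fromℕ< t<n)) K+t≡))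

  Good⇒State : ∀ {s A} → Good s A → State s K A
  Good⇒State {s} (F , std) = F , λ s≤p p⋖q →
    key-gap-mono (m≤m+n K s) (value-gap F s≤p) (std s≤p p⋖q)

  State⇒Good : ∀ {s A} → State s K A → Good s A
  State⇒Good {s} (F , std) = F , λ s≤p p⋖q →
    key-gap-cancel (m≤m+n K s) (value-gap F (≤-trans s≤p (⋖-row p⋖q))) (std s≤p p⋖q)

  -- There are as many cells as values. With `x` as an additional pigeon some two must collide, and
  -- injectivity allows this only between `x` and a cell.
  attained : ∀ {s A} → Frame s A → ∀ {x} → x < K + n → ∃ λ p → A p ≡ x
  attained {A = A} F {x} x<K+n with pigeonhole more f
    where
    more : K + n < suc (n * suc k)
    more = s≤s (≤-reflexive (trans (+-comm K n) (sym (*-suc n k))))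
    f : Fin (suc (n * suc k)) → Fin (K + n)
    f zero    = fromℕ< x<K+n
    f (suc i) = fromℕ< (bounded F (remQuot (suc k) i))
  ... | zero  , suc j , _ , e = remQuot (suc k) j , sym (Finₚ.fromℕ<-injective _ _ _ _ e)
  ... | suc i , suc j , i<j , e = contradiction
    (trans (sym (combine-remQuot {n} (suc k) i)) (trans
      (cong (λ (r , c) → combine r c) (injective F (Finₚ.fromℕ<-injective _ _ _ _ e)))
      (combine-remQuot {n} (suc k) j)))
    (<⇒≢ (s≤s⁻¹ i<j) ∘ cong toℕ)

  -- The end of a slide: the hole in the corner and a new finished row.

  module Closing {s : ℕ} {A : Arr} (F : Frame s A) (std : Std s (key (hole s) 0 ∘ A))
    {r : Fin n} (r≡s : toℕ r ≡ s) where

    -- The hole is not in a finished row, whose values differ from it. Among the other rows the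
    -- corner has the least key, and at `v = 0` only the hole can have that.
    corner : A (r , zero) ≡ hole s
    corner with (r' , c) , A≡h ← attained F (+-monoʳ-< K (subst (_< n) r≡s (toℕ<n r)))
      with s ≤? toℕ r' | c
    ... | yes s≤r' | _ = key-zero-minimum (subst (λ x → key (hole s) 0 (A (r , zero)) ≤ key (hole s) 0 x) A≡h
      (≤-trans (Std-row-≤ std s≤r z≤n) (Std-column-≤ std s≤r (subst (_≤ toℕ r') (sym r≡s) s≤r'))))
      where s≤r = ≤-reflexive (sym r≡s)
    ... | no s≰r' | zero = contradiction
      (+-cancelˡ-≡ K _ _ (trans (sym (holes F (≰⇒> s≰r'))) A≡h)) (<⇒≢ (≰⇒> s≰r'))
    ... | no s≰r' | suc c = contradiction A≡h (small≢hole (small F c (≰⇒> s≰r')))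

    elsewhere : ∀ {p} → p ≢ (r , zero) → A p ≢ hole s
    elsewhere p≢ A≡h = p≢ (injective F (trans A≡h (sym corner)))

    -- An entry of this row that is not small exceeds hole s, and the column below it increases, which
    -- leaves too few values below K + n for its n - s cells.
    corner-row-small : ∀ c → A (r , suc c) < K
    corner-row-small c with value-gap F (≤-reflexive (sym r≡s))
    ... | inj₁ A<K = A<K
    ... | inj₂ h≤A = contradiction (≤∧≢⇒< h≤A (elsewhere (λ ()) ∘ sym)) (≤⇒≯ A≤h)
      where
      open Increments (λ r' → A (r' , suc c)) s
        (λ s≤i e → key-cancel (elsewhere λ ()) (elsewhere λ ()) (std s≤i (down e)))
      d = n ∸ suc s
      n≡ : suc d + s ≡ n
      n≡ = trans (sym (+-suc d s)) (m∸n+n≡m (subst (_< n) r≡s (toℕ<n r)))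
      last<n : d + s < n
      last<n = ≤-reflexive n≡
      A+d< : d + A (r , suc c) < d + suc (hole s)
      A+d< = <-≤-trans
        (≤-<-trans (gap d {j = fromℕ< last<n} (≤-reflexive (sym r≡s))
                     (trans (toℕ-fromℕ< last<n) (cong (d +_) (sym r≡s))))
                   (bounded F _))
        (≤-reflexive (trans (cong (K +_) (sym n≡)) (trans (+-suc K (d + s)) (trans (cong suc
          (trans (sym (+-assoc K d s)) (trans (cong (_+ s) (+-comm K d)) (+-assoc d K s))))
          (sym (+-suc d (hole s)))))))
      A≤h : A (r , suc c) ≤ hole s
      A≤h = s≤s⁻¹ (+-cancelˡ-< d _ _ A+d<)

    -- Away from the hole the keys order values as usual, and the hole is now known to be in the
    -- corner, so the rest of row `s` and all later rows increase in the ordinary sense.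
    closed : Good (suc s) A
    closed = record
      { injective  = injective F
      ; bounded    = bounded F
      ; holes      = λ r'<1+s → by-row (λ r' → A (r' , zero) ≡ K + toℕ r')
                       (trans corner (cong (K +_) (sym r≡s))) (holes F) r'<1+s
      ; small      = λ c → by-row (λ r' → A (r' , suc c) < K) (corner-row-small c) (small F c)
      ; increasing = λ {r'} {c} {c'} r'<1+s e → by-row (λ r' → A (r' , suc c) < A (r' , suc c'))
          (key-cancel (elsewhere λ ()) (elsewhere λ ())
            (std (≤-reflexive (sym r≡s)) (right (cong suc e))))
          (λ r'<s → increasing F r'<s e) r'<1+s
      } , λ s<p p⋖q → key-cancel (below s<p) (below (≤-trans s<p (⋖-row p⋖q)))
                        (std (<⇒≤ s<p) p⋖q)
      where
      below : ∀ {p} → s < row p → A p ≢ hole s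
      below s<p = elsewhere λ { refl → <-irrefl (sym r≡s) s<p }
      by-row : (P : Fin n → Set) → P r → (∀ {r'} → toℕ r' < s → P r') → ∀ {r'} → toℕ r' < suc s → P r'
      by-row P Pr P< {r'} r'<1+s with m<1+n⇒m<n∨m≡n r'<1+s
      ... | inj₁ r'<s = P< r'<s
      ... | inj₂ r'≡s = subst P (toℕ-injective (trans r≡s (sym r'≡s))) Pr

  -- Putting row `s` back on top requires a check only in the columns other than 0: in column 0
  -- stands the hole, which at `v = 0` is below everything.
  reopen : ∀ {s A} → Good (suc s) A →
           (∀ {r r' c} → toℕ r ≡ s → toℕ r' ≡ suc s → A (r , suc c) < A (r' , suc c)) → State s 0 A
  reopen {s} {A} (F , std) columns = Frame-weaken F , λ s≤p p⋖q →
    key-zero-mono (not-corner s≤p p⋖q) (compare s≤p p⋖q)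
    where
    hole-at : ∀ {r} → toℕ r ≡ s → A (r , zero) ≡ hole s
    hole-at r≡s = trans (holes F (s≤s (≤-reflexive r≡s))) (cong (K +_) r≡s)
    not-corner : ∀ {p q} → s ≤ row p → p ⋖ q → A q ≢ hole s
    not-corner {r , c} {q} s≤r p⋖q Aq≡h with <-cmp s (row q)
    ... | tri> _ _ q<s = <⇒≱ q<s (≤-trans s≤r (⋖-row p⋖q))
    ... | tri≈ _ s≡q _ with injective F (trans Aq≡h (sym (hole-at {proj₁ q} (sym s≡q)))) | p⋖q
    ...   | refl | right ()
    ...   | refl | down e = <⇒≱ (≤-reflexive (sym e)) (subst (_≤ toℕ r) s≡q s≤r)
    not-corner {r , c} {q} s≤r p⋖q Aq≡h | tri< s<q _ _ =
      <-irrefl (sym (trans (cong row (injective F (trans Aq≡h (sym (hole-at (toℕ-fromℕ< s<n))))))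
                           (toℕ-fromℕ< s<n))) s<q
      where s<n = <-trans s<q (toℕ<n (proj₁ q))
    compare : ∀ {p q} → s ≤ row p → p ⋖ q → A p ≡ hole s ⊎ A p < A q
    compare {r , c} s≤r p⋖q with m≤n⇒m<n∨m≡n s≤r
    ... | inj₁ s<r = inj₂ (std s<r p⋖q)
    compare {r , zero} s≤r p⋖q | inj₂ s≡r = inj₁ (hole-at (sym s≡r))
    compare {r , suc c} s≤r (right {c' = suc c'} e) | inj₂ s≡r =
      inj₂ (increasing F (s≤s (≤-reflexive (sym s≡r))) (suc-injective e))
    compare {r , suc c} s≤r (down e) | inj₂ s≡r =
      inj₂ (columns (sym s≡r) (trans e (cong suc (sym s≡r))))

  -- The effect of a slide on the first unfinished row.

  -- What Schensted's theorem needs from the slide A ↦ B at stage s = r: row r of A consists of the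
  -- hole, entries of row r of B, and entries that B has directly below.
  record Link (s : ℕ) (r : Fin n) (A B : Arr) : Set where
    field
      below : ∀ {r'} c → toℕ r' ≡ suc s → A (r , c) ≤ B (r' , c)
      from  : ∀ c → B (r , c) ≡ hole s ⊎ (∃ λ d → B (r , c) ≡ A (r , d))
      to    : ∀ c → A (r , c) ≡ hole s ⊎ (∃ λ r' → toℕ r' ≡ suc s × A (r , c) ≡ B (r' , c)) ⊎
                    (∃ λ d → A (r , c) ≡ B (r , d))

  open Link

  -- Row r is untouched until the hole enters it, and afterwards the hole stays in it.
  data Phase (s : ℕ) (r : Fin n) (A B : Arr) : Set where
    before : (∀ c → B (r , c) ≡ A (r , c)) → (∀ c → B (r , c) ≢ hole s) → Phase s r A B
    after  : ∀ c → B (r , c) ≡ hole s → Link s r A B → Phase s r A B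

  Link-cong : ∀ {s r A B C} → B ≗ C → Link s r A B → Link s r A C
  Link-cong B≗C link = record
    { below = λ c e → subst (_ ≤_) (B≗C _) (below link c e)
    ; from  = λ c → Data.Sum.map (trans (sym (B≗C _))) (λ (d , e) → d , trans (sym (B≗C _)) e)
                      (from link c)
    ; to    = λ c → Data.Sum.map₂ (Data.Sum.map (λ (r' , e , e′) → r' , e , trans e′ (B≗C _))
                      (λ (d , e) → d , trans e (B≗C _))) (to link c)
    }

  Phase-cong : ∀ {s r A B C} → B ≗ C → Phase s r A B → Phase s r A C
  Phase-cong B≗C (before same no-hole) =
    before (λ c → trans (sym (B≗C _)) (same c)) (λ c → no-hole c ∘ trans (B≗C _))
  Phase-cong B≗C (after c hole-at link) = after c (trans (sym (B≗C _)) hole-at) (Link-cong B≗C link)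

  -- The hole can enter row `r` only from below, and then one entry drops into the next row in the
  -- same column. After that it can only move left, because the rows above are finished.
  Phase-Step : ∀ {s r A} → toℕ r ≡ s → ∀ {v B C} → v < K → Frame s B → State s v C → Step s v B C →
               Phase s r A B → Phase s r A C
  Phase-Step r≡s v<K F state (stay C≗B) phase = Phase-cong (sym ∘ C≗B) phase
  Phase-Step {s} {r} {A} r≡s {v} {B} {C} v<K F (F′ , std) (move {p} {q} s≤p p⋖q Bp≡v Bq≡h C≗) phase =
    cases phase p⋖q (proj₁ p Finₚ.≟ r)
    where
    Cp≡h : C p ≡ hole s
    Cp≡h = trans (C≗ p) (trans (cong (exchange v (hole s)) Bp≡v) (exchange-left v (hole s)))
    Cq≡v : C q ≡ v
    Cq≡v = trans (C≗ q) (trans (cong (exchange v (hole s)) Bq≡h) (exchange-right v (hole s)))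
    C-other : ∀ {x} → x ≢ p → x ≢ q → C x ≡ B x
    C-other x≢p x≢q = trans (C≗ _) (exchange-other
      (λ e → x≢p (injective F (trans e (sym Bp≡v)))) (λ e → x≢q (injective F (trans e (sym Bq≡h)))))
    C≢h : ∀ {x} → x ≢ p → C x ≢ hole s
    C≢h x≢p e = x≢p (injective F′ (trans e (sym Cp≡h)))

    leave : ∀ {r' c} → p ≡ (r , c) → q ≡ (r' , c) → toℕ r' ≡ suc (toℕ r) →
            (∀ d → B (r , d) ≡ A (r , d)) → Link s r A C
    leave {r'} {c} refl refl e same = record { below = below′ ; from = from′ ; to = to′ }
      where
      r≢r' : r ≢ r'
      r≢r' refl = 1+n≢n (sym e)
      unmoved : ∀ {d} → d ≢ c → C (r , d) ≡ A (r , d)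
      unmoved d≢c = trans (C-other (λ { refl → d≢c refl }) (λ { refl → d≢c refl })) (same _)
      dropped : C (r' , c) ≡ A (r , c)
      dropped = trans Cq≡v (trans (sym Bp≡v) (same c))
      -- In the column of the drop both sides are equal; in any other column neither cell holds the
      -- hole, and standardness of `C` applies.
      below′ : ∀ {r''} d → toℕ r'' ≡ suc s → A (r , d) ≤ C (r'' , d)
      below′ d e′ with refl ← toℕ-injective (trans e′ (trans (cong suc (sym r≡s)) (sym e)))
        with d Finₚ.≟ c
      ... | yes refl = ≤-reflexive (sym dropped)
      ... | no d≢c   = <⇒≤ (subst (_< C (r' , d)) (unmoved d≢c) (key-cancel
        (C≢h λ { refl → d≢c refl }) (C≢h λ { refl → d≢c refl }) (std s≤p (down e))))
      from′ : ∀ d → C (r , d) ≡ hole s ⊎ (∃ λ d' → C (r , d) ≡ A (r , d'))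
      from′ d with d Finₚ.≟ c
      ... | yes refl = inj₁ Cp≡h
      ... | no d≢c   = inj₂ (d , unmoved d≢c)
      to′ : ∀ d → A (r , d) ≡ hole s ⊎ (∃ λ r'' → toℕ r'' ≡ suc s × A (r , d) ≡ C (r'' , d)) ⊎
                  (∃ λ d' → A (r , d) ≡ C (r , d'))
      to′ d with d Finₚ.≟ c
      ... | yes refl = inj₂ (inj₁ (r' , trans e (cong suc r≡s) , sym dropped))
      ... | no d≢c   = inj₂ (inj₂ (d , sym (unmoved d≢c)))

    along : ∀ {c₀ c} → q ≡ (r , c₀) → p ≡ (r , c) → Link s r A B → Link s r A C
    along {c₀} {c} refl refl link = record { below = below′ ; from = from′ ; to = to′ }
      where
      next-row : ∀ {r' d} → toℕ r' ≡ suc s → C (r' , d) ≡ B (r' , d)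
      next-row e = C-other (λ { refl → 1+n≢n (trans (sym e) r≡s) })
                           (λ { refl → 1+n≢n (trans (sym e) r≡s) })
      below′ : ∀ {r'} d → toℕ r' ≡ suc s → A (r , d) ≤ C (r' , d)
      below′ d e = subst (A (r , d) ≤_) (sym (next-row e)) (below link d e)
      from′ : ∀ d → C (r , d) ≡ hole s ⊎ (∃ λ d' → C (r , d) ≡ A (r , d'))
      from′ d with exchangeView v (hole s) (B (r , d))
      ... | is-left _ e    = inj₁ (trans (C≗ _) e)
      ... | is-right _ e   = Data.Sum.map (trans e′) (λ (d' , e″) → d' , trans e′ e″) (from link c)
        where e′ = trans (C≗ _) (trans e (sym Bp≡v))
      ... | is-other _ _ e = Data.Sum.map (trans e′) (λ (d' , e″) → d' , trans e′ e″) (from link d)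
        where e′ = trans (C≗ _) e
      to′ : ∀ d → A (r , d) ≡ hole s ⊎ (∃ λ r' → toℕ r' ≡ suc s × A (r , d) ≡ C (r' , d)) ⊎
                  (∃ λ d' → A (r , d) ≡ C (r , d'))
      to′ d with to link d
      ... | inj₁ e = inj₁ e
      ... | inj₂ (inj₁ (r' , r'≡ , e)) = inj₂ (inj₁ (r' , r'≡ , trans e (sym (next-row r'≡))))
      ... | inj₂ (inj₂ (d' , e)) with exchangeView v (hole s) (B (r , d'))
      -- The entry displaced by the hole now stands in the column the hole has just left.
      ...   | is-left B≡v _   = inj₂ (inj₂ (c₀ , trans e (trans B≡v (sym Cq≡v))))
      ...   | is-right B≡h _  = inj₁ (trans e B≡h)
      ...   | is-other _ _ e′ = inj₂ (inj₂ (d' , trans e (sym (trans (C≗ _) e′))))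

    cases : Phase s r A B → p ⋖ q → Dec (proj₁ p ≡ r) → Phase s r A C
    cases (before same no-hole) _         (no p≢r) = before
      (λ c → trans (unmoved c) (same c)) (λ c → no-hole c ∘ trans (sym (unmoved c)))
      where
      unmoved : ∀ c → C (r , c) ≡ B (r , c)
      unmoved c = C-other (λ { refl → p≢r refl }) (λ { refl → no-hole c Bq≡h })
    cases (before same no-hole) (right _) (yes refl) = contradiction Bq≡h (no-hole _)
    cases (before same no-hole) (down e)  (yes refl) = after _ Cp≡h (leave refl refl e same)
    cases (after c₀ B≡h link) p⋖q _ with injective F (trans Bq≡h (sym B≡h)) | p⋖q
    ... | refl | right _ = after _ Cp≡h (along refl refl link)
    ... | refl | down e  = contradiction s≤p (<⇒≱ (subst (_ <_) r≡s (≤-reflexive (sym e))))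

  -- The slide ends with the hole in the corner of row `r`, so the phase `before` cannot persist to
  -- the end.
  slide↓-Link : ∀ {s r A} → toℕ r ≡ s → Good s A → Link s r A (slide↓ s K A)
  slide↓-Link {s} {r} {A} r≡s good@(_ , std) =
    conclude (slide↓-induction (Phase s r A) (Phase-Step r≡s) K ≤-refl (Good⇒State good)
               (start (any? λ c → A (r , c) ≟ hole s)))
    where
    start : Dec (∃ λ c → A (r , c) ≡ hole s) → Phase s r A A
    start (no no-hole)  = before (λ _ → refl) (λ c e → no-hole (c , e))
    start (yes (c , e)) = after c e record
      { below = λ d r'≡ → <⇒≤ (std (≤-reflexive (sym r≡s)) (down (trans r'≡ (cong suc (sym r≡s)))))
      ; from  = λ d → inj₂ (d , refl)
      ; to    = λ d → inj₂ (inj₂ (d , refl))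
      }
    conclude : ∀ {B} → State s 0 B × Phase s r A B → Link s r A B
    conclude ((F , std₀) , before _ no-hole) = contradiction (Closing.corner F std₀ r≡s) (no-hole zero)
    conclude (_ , after _ _ link) = link

  -- The word contained in an array, and its increasing subsequences.

  Entry : Set
  Entry = Fin n × Fin k

  entry-row : Entry → ℕ
  entry-row q = toℕ (proj₁ q)

  value : Arr → Entry → ℕ
  value W q = W (proj₁ q , suc (proj₂ q))

  -- The blocks of the word are the rows of the final array, read from the bottom row upwards.
  data _≺_ : Entry → Entry → Set where
    upwards : ∀ {r r' c c'} → toℕ r' < toℕ r → (r , c) ≺ (r' , c')
    along   : ∀ {r c c'} → toℕ c < toℕ c' → (r , c) ≺ (r , c')

  ≺-row : ∀ {p q} → p ≺ q → entry-row q ≤ entry-row p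
  ≺-row (upwards r'<r) = <⇒≤ r'<r
  ≺-row (along _)      = ≤-refl

  ≺-trans : ∀ {p q t} → p ≺ q → q ≺ t → p ≺ t
  ≺-trans (upwards a) (upwards b) = upwards (<-trans b a)
  ≺-trans (upwards a) (along _)   = upwards a
  ≺-trans (along _)   (upwards b) = upwards b
  ≺-trans (along a)   (along b)   = along (<-trans a b)

  -- Chain W m q is an increasing subsequence with m + 1 terms that ends at q.
  data Chain (W : Arr) : ℕ → Entry → Set where
    single : ∀ {q} → Chain W 0 q
    snoc   : ∀ {m p q} → Chain W m p → p ≺ q → value W p < value W q → Chain W (suc m) q

  Chain-cong : ∀ {V W m q} → V ≗ W → Chain V m q → Chain W m q
  Chain-cong V≗W single           = single
  Chain-cong V≗W (snoc ch p≺q lt) = snoc (Chain-cong V≗W ch) p≺q (subst₂ _<_ (V≗W _) (V≗W _) lt)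

  NoLongChain : Arr → Set
  NoLongChain W = ∀ {q} → ¬ Chain W (suc k) q

  module FrozenRow {s : ℕ} {W : Arr} (F : Frame s W) {r : Fin n} (r<s : toℕ r < s) =
    Increments (λ c → W (r , suc c)) 0 (λ _ e → increasing F r<s e)

  module FullFrame {W : Arr} (F : Frame n W) where

    extend : ∀ d {m r c} → suc d + toℕ c ≡ k → Chain W m (r , c) → ∃ λ q → Chain W (d + m) q
    extend zero    _ ch = _ , ch
    extend (suc d) {m} {r} {c} e ch =
      Data.Product.map₂ (λ {q} → subst (λ x → Chain W x q) (+-suc d m))
        (extend d {r = r} {c = next}
          (trans (cong (suc d +_) next≡) (trans (+-suc (suc d) (toℕ c)) e))
          (snoc ch (along (≤-reflexive (sym next≡))) (increasing F (toℕ<n r) next≡)))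
      where
      next<k : suc (toℕ c) < k
      next<k = subst (suc (toℕ c) <_) e (s≤s (s≤s (m≤n+m (toℕ c) d)))
      next = fromℕ< next<k
      next≡ : toℕ next ≡ suc (toℕ c)
      next≡ = toℕ-fromℕ< next<k

    -- A chain of `toℕ c + 3` terms ending in column `c` continues through the `k - 1 - toℕ c`
    -- entries to its right, which makes `k + 2` terms.
    excess : ∀ {r c} → NoLongChain W → ¬ Chain W (suc (suc (toℕ c))) (r , c)
    excess {r} {c} none ch = none (subst (λ x → Chain W x (proj₁ (extend d e ch)))
      (trans (+-suc d (suc (toℕ c))) (cong suc (trans (+-suc d _) e))) (proj₂ (extend d e ch)))
      where
      d = k ∸ suc (toℕ c)
      e : suc d + toℕ c ≡ k
      e = trans (sym (+-suc d (toℕ c))) (m∸n+n≡m (toℕ<n c))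

    row-Chain : ∀ m {r c} → toℕ c ≡ m → Chain W m (r , c)
    row-Chain zero    _ = single
    row-Chain (suc m) {r} {c} e = snoc (row-Chain m prev≡) (along (≤-reflexive (sym c≡)))
      (increasing F (toℕ<n r) c≡)
      where
      prev<k : m < k
      prev<k = <-trans (≤-reflexive (sym e)) (toℕ<n c)
      prev≡ : toℕ (fromℕ< prev<k) ≡ m
      prev≡ = toℕ-fromℕ< prev<k
      c≡ : toℕ c ≡ suc (toℕ (fromℕ< prev<k))
      c≡ = trans e (cong suc (sym prev≡))

  -- Iterated slides and Schensted's theorem.

  descend : ℕ → ℕ → Arr → Arr
  descend zero    s A = A
  descend (suc d) s A = descend d (suc s) (slide↓ s K A)

  ascend : ℕ → ℕ → Arr → Arr
  ascend zero    s W = W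
  ascend (suc d) s W = slide↑ s K (ascend d (suc s) W)

  descend-cong : ∀ d s {A B} → A ≗ B → descend d s A ≗ descend d s B
  descend-cong zero    s A≗B = A≗B
  descend-cong (suc d) s A≗B = descend-cong d (suc s) (slide↓-cong s K A≗B)

  ascend-cong : ∀ d s {A B} → A ≗ B → ascend d s A ≗ ascend d s B
  ascend-cong zero    s A≗B = A≗B
  ascend-cong (suc d) s A≗B = slide↑-cong s K (ascend-cong d (suc s) A≗B)

  -- ChainBound and ChainAttained are the two halves of Schensted's theorem for row s.
  ChainBound : ℕ → Arr → Arr → Set
  ChainBound s A W = ∀ {m q r} → s ≤ entry-row q → toℕ r ≡ s → Chain W m q →
                     ∃ λ c → toℕ c ≡ m × A (r , c) ≤ value W q

  -- For an end below row `s`, the bound from the next row passes up through `below`. For an end in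
  -- row `s`, its value is some `A (r , d)`; the column found for the preceding term is left of `d`,
  -- so the next column is at most `d`.
  ChainBound-step : ∀ {s A B W} → Good s A → Frame (suc s) B → (∀ {r} → toℕ r ≡ s → Link s r A B) →
                    Agree (suc s) B W → ChainBound (suc s) B W → ChainBound s A W
  ChainBound-step {s} {A} {B} {W} (F , std) F′ link agree bound′ = bound
    where
    bound : ChainBound s A W
    bound {q = r' , c} {r} s≤r' r≡s ch with m≤n⇒m<n∨m≡n s≤r'
    ... | inj₁ s<r'
      with d , d≡m , le ← bound′ s<r' (toℕ-fromℕ< (≤-<-trans s<r' (toℕ<n r'))) ch =
      d , d≡m , ≤-trans (below (link r≡s) d (toℕ-fromℕ< _)) le
    ... | inj₂ s≡r' with refl ← toℕ-injective (trans r≡s s≡r') | from (link r≡s) (suc c)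
    ...   | inj₁ B≡h = contradiction B≡h (small≢hole (small F′ c (s≤s (≤-reflexive r≡s))))
    ...   | inj₂ (d , B≡A) = place ch
      where
      W≡A : W (r , suc c) ≡ A (r , d)
      W≡A = trans (agree _ (s≤s (≤-reflexive r≡s))) B≡A
      place : ∀ {m} → Chain W m (r , c) → ∃ λ c' → toℕ c' ≡ m × A (r , c') ≤ W (r , suc c)
      place single = zero , refl , subst (_ ≤_) (sym W≡A) (Std-row-≤ std s≤r' z≤n)
      place (snoc ch′ p≺q lt) with d' , refl , le ← bound (≤-trans s≤r' (≺-row p≺q)) r≡s ch′ =
        fromℕ< next< , toℕ-fromℕ< next< , subst (A (r , fromℕ< next<) ≤_) (sym W≡A)
          (Std-row-≤ std s≤r' (subst (_≤ toℕ d) (sym (toℕ-fromℕ< next<)) d'<d))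
        where
        d'<d : toℕ d' < toℕ d
        d'<d = ≰⇒> λ d≤d' → <⇒≱ (subst (_ <_) W≡A (≤-<-trans le lt)) (Std-row-≤ std s≤r' d≤d')
        next< : suc (toℕ d') < suc k
        next< = ≤-<-trans d'<d (toℕ<n d)

  -- The conclusions share one induction: agreement says that later slides leave row `s` alone, and
  -- the chain bound relies on it.
  descend-correct : ∀ d s {A} → d + s ≡ n → Good s A → let W = descend d s A in
    Frame n W × Agree s A W × ascend d s W ≗ A × ChainBound s A W
  descend-correct zero    _ refl (F , _) = F , (λ _ _ → refl) , (λ _ → refl) ,
    λ {_} {q} n≤q → contradiction n≤q (<⇒≱ (toℕ<n (proj₁ q)))
  descend-correct (suc d) s {A} e good@(F , std)
    with (F₀ , std₀) , agree₀ ← slide↓-State K ≤-refl (Good⇒State good)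
    with good′ ← Closing.closed F₀ std₀ {fromℕ< (m+n≤o⇒n≤o d (≤-reflexive (trans (+-suc d s) e)))}
                   (toℕ-fromℕ< _)
    with FW , agree , inverse , bound ← descend-correct d (suc s) (trans (+-suc d s) e) good′ =
    FW ,
    (λ p p<s → trans (agree p (m<n⇒m<1+n p<s)) (agree₀ p p<s)) ,
    (λ p → trans (slide↑-cong s K inverse p) (slide↑∘slide↓ K ≤-refl (Good⇒State good) p)) ,
    ChainBound-step good (proj₁ good′) (λ r≡s → slide↓-Link r≡s good) agree bound

  ChainAttained : ℕ → Arr → Arr → Set
  ChainAttained s A W = ∀ m {r} c → toℕ c ≡ m → toℕ r ≡ s → A (r , c) < K →
                        ∃ λ q → s ≤ entry-row q × value W q ≡ A (r , c) × Chain W m q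

  -- A small entry of row `s` either dropped into the next row, same column, where a chain is
  -- already known, or stayed and became a term of the word. In the second case it is appended to
  -- the chain for its left neighbour in `A`.
  ChainAttained-step : ∀ {s A B W} → Good s A → Frame (suc s) B → (∀ {r} → toℕ r ≡ s → Link s r A B) →
                       Frame n W → Agree (suc s) W B → ChainAttained (suc s) B W → ChainAttained s A W
  ChainAttained-step {s} {A} {B} {W} (F , std) F′ link FW agree attained′ = find
    where
    find : ChainAttained s A W
    find m {r} c c≡m r≡s A<K with to (link r≡s) c
    ... | inj₁ A≡h = contradiction A≡h (small≢hole A<K)
    ... | inj₂ (inj₁ (r' , r'≡ , A≡B))
      with q , s<q , W≡B , ch ← attained′ m c c≡m r'≡ (subst (_< K) A≡B A<K) =
      q , <⇒≤ s<q , trans W≡B (sym A≡B) , ch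
    ... | inj₂ (inj₂ (zero , A≡B)) = contradiction
      (subst (_< K) (trans A≡B (holes F′ (s≤s (≤-reflexive r≡s)))) A<K) (≤⇒≯ (m≤m+n K _))
    find zero {r} c c≡m r≡s A<K | inj₂ (inj₂ (suc d , A≡B)) =
      (r , d) , ≤-reflexive (sym r≡s) ,
      trans (sym (agree _ (s≤s (≤-reflexive r≡s)))) (sym A≡B) , single
    find (suc m) {r} c c≡m r≡s A<K | inj₂ (inj₂ (suc d , A≡B)) = extended (find m prev prev≡ r≡s (<-trans A< A<K))
      where
      prev< : m < suc k
      prev< = <-trans (≤-reflexive (sym c≡m)) (toℕ<n c)
      prev = fromℕ< prev<
      prev≡ : toℕ prev ≡ m
      prev≡ = toℕ-fromℕ< prev<
      A< : A (r , prev) < A (r , c)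
      A< = Std-row std (≤-reflexive (sym r≡s)) (≤-reflexive (trans (cong suc prev≡) (sym c≡m)))
      W≡A : W (r , suc d) ≡ A (r , c)
      W≡A = trans (sym (agree _ (s≤s (≤-reflexive r≡s)))) (sym A≡B)
      extended : (∃ λ q → s ≤ entry-row q × value W q ≡ A (r , prev) × Chain W m q) →
                 ∃ λ q → s ≤ entry-row q × value W q ≡ A (r , c) × Chain W (suc m) q
      extended ((r' , d') , s≤r' , W≡ , ch) =
        (r , d) , ≤-reflexive (sym r≡s) , W≡A , snoc ch precedes lt
        where
        lt : W (r' , suc d') < W (r , suc d)
        lt = subst₂ _<_ (sym W≡) (sym W≡A) A<
        precedes : (r' , d') ≺ (r , d)
        precedes with m≤n⇒m<n∨m≡n s≤r'
        ... | inj₁ s<r' = upwards (subst (_< toℕ r') (sym r≡s) s<r')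
        -- Within a finished row the order of the values determines the order of the places.
        ... | inj₂ s≡r' with refl ← toℕ-injective (trans r≡s s≡r') =
          along (≰⇒> λ d≤d' → <⇒≱ lt (FrozenRow.monotone FW (toℕ<n r) z≤n d≤d'))

  -- Avoidance enters only through `columns`, which lets each block fit on the tableau below it; the
  -- chains needed there come from the same induction.
  ascend-correct : ∀ d s {W} → d + s ≡ n → Frame n W → NoLongChain W → let A = ascend d s W in
    Good s A × Agree s W A × descend d s A ≗ W × ChainAttained s A W
  ascend-correct zero    _ {W} refl F _ =
    (F , λ {p} n≤p → contradiction n≤p (<⇒≱ (toℕ<n (proj₁ p)))) , (λ _ _ → refl) , (λ _ → refl) ,
    λ m {r} c _ r≡n → contradiction r≡n (<⇒≢ (toℕ<n r))
  ascend-correct (suc d) s {W} e F none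
    with good@(F′ , std′) , agree , inverse , attained ←
           ascend-correct d (suc s) (trans (+-suc d s) e) F none =
    goodA ,
    (λ p p<s → trans (proj₂ up p p<s) (agree p (m<n⇒m<1+n p<s))) ,
    (λ p → trans (descend-cong d (suc s) restored p) (inverse p)) ,
    ChainAttained-step goodA F′ link F agree attained
    where
    B = ascend d (suc s) W
    -- If the lower entry were smaller, it would end a chain of `toℕ c + 2` terms inside the lower
    -- rows; the block entry in column `c` would extend that chain, against `excess`.
    columns : ∀ {r r' c} → toℕ r ≡ s → toℕ r' ≡ suc s → B (r , suc c) < B (r' , suc c)
    columns {r} {r'} {c} r≡s r'≡ with <-cmp (B (r , suc c)) (B (r' , suc c))
    ... | tri< lt _ _ = lt
    ... | tri≈ _ eq _ = contradiction
      (trans (sym r≡s) (trans (cong row (injective F′ eq)) r'≡)) (<⇒≢ ≤-refl)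
    ... | tri> _ _ gt with q , s<q , W≡B , ch ← attained (suc (toℕ c)) (suc c) refl r'≡
                             (<-trans gt (small F′ c (s≤s (≤-reflexive r≡s)))) =
      contradiction
        (snoc ch (upwards (subst (_< entry-row q) (sym r≡s) s<q))
          (subst₂ _<_ (sym W≡B) (agree _ (s≤s (≤-reflexive r≡s))) gt))
        (FullFrame.excess F none)
    state₀ = reopen good columns
    up = slide↑-State K ≤-refl state₀
    goodA : Good s (slide↑ s K B)
    goodA = State⇒Good (proj₁ up)
    restored : slide↓ s K (slide↑ s K B) ≗ B
    restored = slide↓∘slide↑ K ≤-refl state₀
    -- The upward slide is viewed as a downward slide reversed, so the same `Link` serves both
    -- directions.
    link : ∀ {r} → toℕ r ≡ s → Link s r (slide↑ s K B) B
    link r≡s = Link-cong restored (slide↓-Link r≡s goodA)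

  -- Translation between words and arrays.

  position : Entry → Fin K
  position q = combine (opposite (proj₁ q)) (proj₂ q)

  at-position : Fin K → Entry
  at-position x = opposite (proj₁ (remQuot {n} k x)) , proj₂ (remQuot {n} k x)

  position-at : ∀ x → position (at-position x) ≡ x
  position-at x = trans
    (cong (λ i → combine i (proj₂ (remQuot {n} k x))) (opposite-involutive (proj₁ (remQuot {n} k x))))
    (combine-remQuot {n} k x)

  at-combine : ∀ i j → at-position (combine i j) ≡ (opposite i , j)
  at-combine i j = cong (λ (i , j) → opposite i , j) (remQuot-combine i j)

  position-mono : ∀ {p q} → p ≺ q → position p Fin.< position q
  position-mono {r , c} {r' , c'} (upwards r'<r) = combine-monoˡ-< c c' (opposite-anti r'<r)
  position-mono {r , c} {r , c'} (along c<c') = subst₂ _<_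
    (sym (toℕ-combine (opposite r) c)) (sym (toℕ-combine (opposite r) c'))
    (+-monoʳ-< (k * toℕ (opposite r)) c<c')

  position-cancel : ∀ {p q} → position p Fin.< position q → p ≺ q
  position-cancel {r , c} {r' , c'} lt with <-cmp (toℕ r') (toℕ r)
  ... | tri< r'<r _ _ = upwards r'<r
  ... | tri> _ _ r<r' = contradiction lt (<-asym (position-mono {r' , c'} {r , c} (upwards r<r')))
  ... | tri≈ _ r'≡r _ with refl ← toℕ-injective r'≡r | <-cmp (toℕ c) (toℕ c')
  ...   | tri< c<c' _ _ = along c<c'
  ...   | tri> _ _ c'<c = contradiction lt (<-asym (position-mono {r , c'} {r , c} (along c'<c)))
  ...   | tri≈ _ c≡c' _ with refl ← toℕ-injective c≡c' = contradiction lt (<-irrefl refl)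

  -- Blocks occupy columns 1 to k; column 0 is where the n slides leave their holes.
  fill : (Fin K → Fin K) → Arr
  fill w (r , zero)  = K + toℕ r
  fill w (r , suc c) = toℕ (w (position (r , c)))

  fill-cong : ∀ {w w'} → w ≗ w' → fill w ≗ fill w'
  fill-cong w≗w' (r , zero)  = refl
  fill-cong w≗w' (r , suc c) = cong toℕ (w≗w' (position (r , c)))

  fill-injective : ∀ {w w'} → fill w ≗ fill w' → w ≗ w'
  fill-injective {w} {w'} e x = toℕ-injective
    (subst (λ y → toℕ (w y) ≡ toℕ (w' y)) (position-at x)
      (e (proj₁ (at-position x) , suc (proj₂ (at-position x)))))

  fill-Frame : ∀ {w} → InL n k w → Frame n (fill w)
  fill-Frame {w} (perm , rows , _) = record
    { injective  = inj
    ; bounded    = λ { (r , zero)  → +-monoʳ-< K (toℕ<n r)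
                     ; (r , suc c) → <-≤-trans (toℕ<n (w (position (r , c)))) (m≤m+n K n) }
    ; holes      = λ _ → refl
    ; small      = λ {r} c _ → toℕ<n (w (position (r , c)))
    ; increasing = λ {r} {c} {c'} _ e → rows (opposite r) c c' e
    }
    where
    inj : ∀ {p q} → fill w p ≡ fill w q → p ≡ q
    inj {r , zero}  {r' , zero}   e = cong (_, zero) (toℕ-injective (+-cancelˡ-≡ K _ _ e))
    inj {r , zero}  {r' , suc c'} e =
      contradiction (subst (_< K) (sym e) (toℕ<n (w (position (r' , c'))))) (≤⇒≯ (m≤m+n K _))
    inj {r , suc c} {r' , zero}   e =
      contradiction (subst (_< K) e (toℕ<n (w (position (r , c))))) (≤⇒≯ (m≤m+n K _))
    inj {r , suc c} {r' , suc c'} e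
      with or≡ , refl ← combine-injective (opposite r) c (opposite r') c' (perm _ _ (toℕ-injective e)) =
      cong (_, suc c) (trans (sym (opposite-involutive r))
        (trans (cong opposite or≡) (opposite-involutive r')))

  chain-entry : ∀ {W m q} → Chain W m q → Fin (suc m) → Entry
  chain-entry {q = q} _    zero    = q
  chain-entry (snoc ch _ _) (suc i) = chain-entry ch i

  chain-entry-mono : ∀ {W m q} (ch : Chain W m q) {i j} → toℕ i < toℕ j →
                     chain-entry ch j ≺ chain-entry ch i ×
                     value W (chain-entry ch j) < value W (chain-entry ch i)
  chain-entry-mono (snoc ch p≺q lt) {zero}  {suc zero}    _   = p≺q , lt
  chain-entry-mono (snoc ch p≺q lt) {zero}  {suc (suc j)} _
    with ≺p , <p ← chain-entry-mono ch {zero} {suc j} (s≤s z≤n) = ≺-trans ≺p p≺q , <-trans <p lt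
  chain-entry-mono (snoc ch _ _)    {suc i} {suc j}       i<j = chain-entry-mono ch (s≤s⁻¹ i<j)

  Avoids⇒NoLongChain : ∀ {w} → Avoids w (incPattern (suc (suc k))) → NoLongChain (fill w)
  Avoids⇒NoLongChain {w} avoids ch = avoids (σ , (λ a b a<b → position-mono (proj₁ (mono a<b))) ,
    λ a b → mk⇔ (cancel a b) (proj₂ ∘ mono))
    where
    -- `chain-entry` counts back from the last term, so `opposite` restores the reading order.
    σ : Fin (suc (suc k)) → Fin K
    σ a = position (chain-entry ch (opposite a))
    mono : ∀ {a b} → toℕ a < toℕ b → chain-entry ch (opposite a) ≺ chain-entry ch (opposite b) ×
                                      toℕ (w (σ a)) < toℕ (w (σ b))
    mono a<b = chain-entry-mono ch (opposite-anti a<b)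
    cancel : ∀ a b → toℕ (w (σ a)) < toℕ (w (σ b)) → toℕ a < toℕ b
    cancel a b lt with <-cmp (toℕ a) (toℕ b)
    ... | tri< a<b _ _ = a<b
    ... | tri≈ _ a≡b _ with refl ← toℕ-injective a≡b = contradiction lt (<-irrefl refl)
    ... | tri> _ _ b<a = contradiction lt (<-asym (proj₂ (mono b<a)))

  NoLongChain⇒Avoids : ∀ {w} → NoLongChain (fill w) → Avoids w (incPattern (suc (suc k)))
  NoLongChain⇒Avoids {w} none (σ , σ-mono , w∘σ⇔) = none (prefix (suc k) top (toℕ-fromℕ< ≤-refl))
    where
    top : Fin (suc (suc k))
    top = fromℕ< ≤-refl
    prefix : ∀ m i → toℕ i ≡ m → Chain (fill w) m (at-position (σ i))
    prefix zero    i _   = single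
    prefix (suc m) i i≡ = snoc (prefix m prev prev≡)
      (position-cancel (subst₂ Fin._<_ (sym (position-at _)) (sym (position-at _)) (σ-mono prev i prev<i)))
      (subst₂ (λ x y → toℕ (w x) < toℕ (w y)) (sym (position-at _)) (sym (position-at _))
        (Equivalence.from (w∘σ⇔ prev i) prev<i))
      where
      prev< : m < suc (suc k)
      prev< = <-trans (≤-reflexive (sym i≡)) (toℕ<n i)
      prev = fromℕ< prev<
      prev≡ : toℕ prev ≡ m
      prev≡ = toℕ-fromℕ< prev<
      prev<i : prev Fin.< i
      prev<i = ≤-reflexive (trans (cong suc prev≡) (sym i≡))

  read : ∀ {W} → Frame n W → Fin K → Fin K
  read F x = fromℕ< (small F (proj₂ (at-position x)) (toℕ<n (proj₁ (at-position x))))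

  toℕ-read : ∀ {W} (F : Frame n W) x → toℕ (read F x) ≡ value W (at-position x)
  toℕ-read F x = toℕ-fromℕ< _

  read-combine : ∀ {W} (F : Frame n W) i j → toℕ (read F (combine i j)) ≡ value W (opposite i , j)
  read-combine {W} F i j = trans (toℕ-read F (combine i j)) (cong (value W) (at-combine i j))

  fill-read : ∀ {W} (F : Frame n W) → fill (read F) ≗ W
  fill-read F (r , zero) = sym (holes F (toℕ<n r))
  fill-read {W} F (r , suc c) =
    trans (read-combine F (opposite r) c) (cong (λ r → W (r , suc c)) (opposite-involutive r))

  read-InL : ∀ {W} (F : Frame n W) → NoLongChain W → InL n k (read F)
  read-InL {W} F none = perm , rows , columns
    where
    perm : IsPerm (read F)
    perm x y e with at-x≡at-y ← injective F (trans (sym (toℕ-read F x)) (trans (cong toℕ e) (toℕ-read F y))) =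
      trans (sym (position-at x)) (trans (cong₂ (λ r c → combine (opposite r) c)
        (cong proj₁ at-x≡at-y) (Finₚ.suc-injective (cong proj₂ at-x≡at-y))) (position-at y))
    rows : ∀ (i : Fin n) (j j' : Fin k) → toℕ j' ≡ suc (toℕ j) →
           toℕ (read F (combine i j)) < toℕ (read F (combine i j'))
    rows i j j' e = subst₂ _<_ (sym (read-combine F i j)) (sym (read-combine F i j'))
      (increasing F (toℕ<n (opposite i)) e)
    columns : ∀ (i i' : Fin n) (j j' : Fin k) → toℕ i' ≡ suc (toℕ i) → toℕ j' ≡ suc (toℕ j) →
              toℕ (read F (combine i' j)) < toℕ (read F (combine i j'))
    columns i i' j j' i'≡ j'≡ = subst₂ _<_ (sym (read-combine F i' j)) (sym (read-combine F i j')) less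
      where
      above : toℕ (opposite i') < toℕ (opposite i)
      above = opposite-anti (≤-reflexive (sym i'≡))
      less : value W (opposite i' , j) < value W (opposite i , j')
      less with <-cmp (value W (opposite i' , j)) (value W (opposite i , j'))
      ... | tri< lt _ _ = lt
      ... | tri≈ _ eq _ = contradiction (cong row (injective F eq)) (<⇒≢ above)
      -- The start of block `i` up to `j'` has `toℕ j + 2` terms, and the offending entry is one
      -- more, in column `j`.
      ... | tri> _ _ gt = contradiction
        (snoc (FullFrame.row-Chain F (suc (toℕ j)) j'≡) (upwards above) gt) (FullFrame.excess F none)

  -- Standard tableaux and the bijection.

  tableau-Good : ∀ {T} → IsSYTRect n (suc k) T → Good 0 (toℕ ∘ T)
  tableau-Good {T} (inj , rows , columns) = record
    { injective  = λ {p} {q} e → let r≡ , c≡ = inj _ _ _ _ (toℕ-injective e) in cong₂ _,_ r≡ c≡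
    ; bounded    = λ p → subst (toℕ (T p) <_) (trans (*-suc n k) (+-comm n K)) (toℕ<n (T p))
    ; holes      = λ ()
    ; small      = λ _ ()
    ; increasing = λ ()
    } , λ { _ (right e) → rows _ _ _ (≤-reflexive (sym e))
          ; _ (down e)  → columns _ _ _ (≤-reflexive (sym e)) }

  tableau : ∀ {s A} → Frame s A → Cell → Fin (n * suc k)
  tableau {A = A} F p = fromℕ< (subst (A p <_) (trans (+-comm K n) (sym (*-suc n k))) (bounded F p))

  toℕ-tableau : ∀ {s A} (F : Frame s A) → toℕ ∘ tableau F ≗ A
  toℕ-tableau F p = toℕ-fromℕ< _

  tableau-IsSYTRect : ∀ {A} (good : Good 0 A) → IsSYTRect n (suc k) (tableau (proj₁ good))
  tableau-IsSYTRect {A} (F , std) =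
    (λ i i' j j' e → let p≡q = injective F {i , j} {i' , j'}
                             (trans (sym (toℕ-tableau F _)) (trans (cong toℕ e) (toℕ-tableau F _)))
                     in cong proj₁ p≡q , cong proj₂ p≡q) ,
    (λ i j j' j<j' → subst₂ _<_ (sym (toℕ-tableau F _)) (sym (toℕ-tableau F _))
                       (Std-row std z≤n j<j')) ,
    (λ i i' j i<i' → subst₂ _<_ (sym (toℕ-tableau F _)) (sym (toℕ-tableau F _))
                       (Std-column std z≤n i<i'))

  -- The bound supplies a column whose index is that of the chain, and the columns end at `k`.
  ChainBound⇒NoLongChain : ∀ {A W} → ChainBound 0 A W → NoLongChain W
  ChainBound⇒NoLongChain bound {q} ch
    with c , c≡1+k , _ ← bound z≤n (toℕ-fromℕ< (≤-<-trans z≤n (toℕ<n (proj₁ q)))) ch =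
    <-irrefl c≡1+k (toℕ<n c)

  bijection : Bijection (LAvoid n k) (SYTRect n k)
  bijection = record
    { to        = to-tableau
    ; cong      = λ {x} {y} → to-cong {x} {y}
    ; bijective = (λ {x} {y} → to-injective {x} {y}) , to-surjective
    }
    where
    Words = ∃ λ w → InL n k w × Avoids w (incPattern (suc (suc k)))
    Tableaux = ∃ λ T → IsSYTRect n (suc k) T

    array : Words → Arr
    array (w , _) = ascend n 0 (fill w)

    correct : (x : Words) → let A = array x ; W = fill (proj₁ x) in
              Good 0 A × Agree 0 W A × descend n 0 A ≗ W × ChainAttained 0 A W
    correct (w , inL , avoids) =
      ascend-correct n 0 (+-identityʳ n) (fill-Frame inL) (Avoids⇒NoLongChain avoids)

    to-tableau : Words → Tableaux
    to-tableau x = tableau (proj₁ (proj₁ (correct x))) , tableau-IsSYTRect (proj₁ (correct x))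

    to-array : ∀ x → toℕ ∘ proj₁ (to-tableau x) ≗ array x
    to-array x = toℕ-tableau (proj₁ (proj₁ (correct x)))

    to-cong : ∀ {x y} → proj₁ x ≗ proj₁ y → proj₁ (to-tableau x) ≗ proj₁ (to-tableau y)
    to-cong {x} {y} x≗y p = toℕ-injective
      (trans (to-array x p) (trans (ascend-cong n 0 (fill-cong x≗y) p) (sym (to-array y p))))

    to-injective : ∀ {x y} → proj₁ (to-tableau x) ≗ proj₁ (to-tableau y) → proj₁ x ≗ proj₁ y
    to-injective {x} {y} e = fill-injective λ p →
      trans (sym (inverse x p)) (trans (descend-cong n 0 arrays p) (inverse y p))
      where
      inverse : ∀ x → descend n 0 (array x) ≗ fill (proj₁ x)
      inverse x = proj₁ (proj₂ (proj₂ (correct x)))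
      arrays : array x ≗ array y
      arrays p = trans (sym (to-array x p)) (trans (cong toℕ (e p)) (to-array y p))

    to-surjective : ∀ (y : Tableaux) → ∃ λ (x : Words) →
                    ∀ {z : Words} → proj₁ z ≗ proj₁ x → proj₁ (to-tableau z) ≗ proj₁ y
    to-surjective (T , isSYT)
      -- The preimage is the word read off after all downward slides; sliding back up restores the
      -- tableau.
      with F , _ , inverse , bound ← descend-correct n 0 (+-identityʳ n) (tableau-Good isSYT) =
      (read F , read-InL F none , NoLongChain⇒Avoids (none ∘ Chain-cong (fill-read F))) ,
      λ {z} z≗ p → toℕ-injective (trans (to-array z p) (trans
        (ascend-cong n 0 (λ q → trans (fill-cong z≗ q) (fill-read F q)) p) (inverse p)))
      where
      none = ChainBound⇒NoLongChain bound

theorem4p1 : (n k : ℕ) → 1 ≤ n → 1 ≤ k → Bijection (LAvoid n k) (SYTRect n k)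
theorem4p1 n k _ _ = Rectangle.bijection n k
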